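{- Let $q$ be a prime power and $d\ge1$ a fixed integer. The number of equivalence classes, under dynamical equivalence, of the dynamical systems $(\mathbb{F}_q, x\mapsto ax^d)$ with $a\in\mathbb{F}_q^*$ is equal to $\tau(\gcd(d-1,q-1))$, where $\tau(m)$ denotes the number of positive divisors of $m$.
   Context: Two dynamical systems $(\mathbb{S},f)$ and $(\mathbb{T},g)$ (maps $f:\mathbb{S}\to\mathbb{S}$, $g:\mathbb{T}\to\mathbb{T}$) are dynamically equivalent if there is a bijection $\sigma:\mathbb{S}\to\mathbb{T}$ with $\sigma^{ -1}\circ g\circ\sigma=f$. $\mathbb{F}_q^*=\mathbb{F}_q\setminus\{0\}$. For $d=1$, $\gcd(0,q-1)=q-1$. -}

module Defs where

open import Level using (0ℓ)
open import Data.Nat using (ℕ; zero; suc)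
open import Data.Nat.Divisibility using (_∣?_)
open import Data.List using (List; length; filter; map; upTo)
open import Data.Fin using (Fin)
open import Data.Product using (Σ; ∃; _×_; _,_; proj₁)
open import Relation.Nullary using (¬_)
open import Relation.Binary.PropositionalEquality using (_≡_)
open import Algebra.Structures using (IsCommutativeRing)
open import Function.Bundles using (_↔_; Inverse)

record FiniteField (q : ℕ) : Set₁ where
  field
    Carrier : Set
    _+_ _*_ : Carrier → Carrier → Carrier
    -_      : Carrier → Carrier
    0# 1#   : Carrier
    isCommutativeRing : IsCommutativeRing _≡_ _+_ _*_ -_ 0# 1#
    0≢1     : ¬ (0# ≡ 1#)
    inverse : ∀ x → ¬ (x ≡ 0#) → Σ Carrier (λ y → x * y ≡ 1#)
    card    : Fin q ↔ Carrier

  infixl 7 _*_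
  infixl 6 _+_

  _^_ : Carrier → ℕ → Carrier
  x ^ zero  = 1#
  x ^ suc n = x * (x ^ n)

  Units : Set
  Units = Σ Carrier (λ a → ¬ (a ≡ 0#))

DynEquiv : {S T : Set} → (S → S) → (T → T) → Set
DynEquiv {S} {T} f g = Σ (S ↔ T) (λ σ → ∀ x → g (Inverse.to σ x) ≡ Inverse.to σ (f x))

HasNClasses : {A : Set} → (A → A → Set) → ℕ → Set
HasNClasses {A} R n =
  Σ (Fin n → A) (λ r →
    (∀ i j → R (r i) (r j) → i ≡ j) ×
    (∀ a → ∃ (λ i → R a (r i))))

-- τ m = number of positive divisors of m (for m ≥ 1)
τ : ℕ → ℕ
τ m = length (filter (λ k → k ∣? m) (map suc (upTo m)))

monomial : ∀ {q} (F : FiniteField q) → FiniteField.Carrier F → ℕ → FiniteField.Carrier F → FiniteField.Carrier F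
monomial F a d x = a * (x ^ d)
  where open FiniteField F

{-# OPTIONS --safe #-}

-- Write n = q − 1, d = 1 + s, and let g generate the cyclic group F*.  In exponents to the base g
-- the system x ↦ g^k x^d is the affine map t ↦ k + d t modulo n.  Substituting x ↦ g^v x^u with u
-- prime to n replaces k by any solution of k + s v ≡ k′ u (mod n); every k can thus be brought to
-- gcd (k, s, n), since a unit modulo a divisor of n lifts to a unit modulo n.
--
-- Conversely k ∣ gcd (s, n) is determined by the set of j for which the j-th iterate has a fixed
-- point in F*, that is, n ∣ (1 + d + ⋯ + d^(j−1)) (k + s t) for some t.  If k ∤ k′, take a prime p
-- with p^(a+1) ∣ k but p^(a+1) ∤ k′.  When p² ∣ s, the geometric sum has exactly the p-adic
-- valuation of j, and a suitable j with valuation v_p(n) − a − 1 works for k but not for k′.  When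
-- p² ∤ s, a suitable j prime to p does.
module Submission where

open import Defs
open import Data.Nat
open import Data.Nat.Properties
open import Data.Nat.Divisibility
open import Data.Nat.DivMod using (_%_; _/_; m≡m%n+[m/n]*n; m%n<n)
open import Data.Nat.GCD using (gcd; gcd[m,n]∣m; gcd[m,n]∣n; gcd-greatest; gcd-GCD; module Bézout)
open import Data.Nat.Coprimality as Coprimality using (Coprime; coprime-divisor; coprime-Bézout)
open import Data.Nat.GeneralisedArithmetic using (fold)
open import Data.Nat.Induction using (<-rec)
open import Data.Nat.ListAction using (product)
open import Data.Nat.Primality using (Prime; prime⇒irreducible; prime⇒nonZero; prime⇒nonTrivial; euclidsLemma; ¬prime[1])
open import Data.Nat.Primality.Factorisation using (factorise; factorisationHasAllPrimeFactors)
open import Data.Nat.Tactic.RingSolver using (solve-∀)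
open import Data.Fin.Base as Fin using (Fin; zero; suc; toℕ; fromℕ<; punchIn; punchOut)
open import Data.Fin.Properties as Fin using (any?; pigeonhole; toℕ-injective; toℕ-fromℕ<; toℕ<n; punchIn-injective; punchInᵢ≢i; punchOut-injective; injective⇒≤)
open import Data.List.Base using (List; []; _∷_; filter; map; upTo; lookup)
open import Data.List.Membership.Propositional using (_∈_)
open import Data.List.Membership.Propositional.Properties using (∈-filter⁺; ∈-filter⁻; ∈-map⁺; ∈-upTo⁺; ∈-lookup)
open import Data.List.Relation.Unary.All as All using (All; []; _∷_)
open import Data.List.Relation.Unary.AllPairs.Core using (_∷_)
import Data.List.Relation.Unary.Any as Any
open import Data.List.Relation.Unary.Any.Properties using (lookup-index)
open import Data.List.Relation.Unary.Unique.Propositional using (Unique)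
import Data.List.Relation.Unary.Unique.Propositional.Properties as Unique
open import Data.Product using (Σ; ∃; ∃₂; _×_; _,_; proj₁; proj₂)
open import Data.Sum.Base using (inj₁; inj₂; [_,_]′)
open import Data.Empty using (⊥; ⊥-elim)
open import Function.Base using (case_of_; _|>_; _∘_; it)
open import Function.Bundles using (_↔_; Inverse; mk↔ₛ′)
open import Function.Definitions using (Injective)
open import Function.Properties.Inverse using (↔-sym)
open import Algebra.Bundles using (CommutativeRing)
open import Relation.Binary.Definitions using (DecidableEquality)
open import Relation.Nullary using (¬_; yes; no; contradiction; ¬?; _×-dec_)
open import Relation.Nullary.Decidable using (map′; decidable-stable)
open import Relation.Binary.PropositionalEquality

-- Primes and congruences

∣⇒nonZero : ∀ {m n} .{{_ : NonZero n}} → m ∣ n → NonZero m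
∣⇒nonZero {m} (divides q refl) = m*n≢0⇒n≢0 q

prime-divisor : ∀ n .{{_ : NonZero n}} → n ≢ 1 → ∃ λ p → Prime p × p ∣ n
prime-divisor n n≢1 with factorise n
... | record { factors = [] ; isFactorisation = n≡1 } = ⊥-elim (n≢1 n≡1)
... | record { factors = p ∷ ps ; isFactorisation = refl ; factorsPrime = p-prime ∷ _ } =
  p , p-prime , m∣m*n (product ps)

no-common-prime⇒coprime : ∀ {m n} .{{_ : NonZero n}} →
  (∀ {p} → Prime p → p ∣ m → p ∣ n → ⊥) → Coprime m n
no-common-prime⇒coprime {m} {n} none {d} (d∣m , d∣n) with d ≟ 1
... | yes d≡1 = d≡1
... | no d≢1 =
  let p , p-prime , p∣d = prime-divisor d {{∣⇒nonZero d∣n}} d≢1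
  in ⊥-elim (none p-prime (∣-trans p∣d d∣m) (∣-trans p∣d d∣n))

prime∧∤⇒coprime : ∀ {p n} → Prime p → ¬ p ∣ n → Coprime p n
prime∧∤⇒coprime p-prime p∤n (d∣p , d∣n) with prime⇒irreducible p-prime d∣p
... | inj₁ d≡1 = d≡1
... | inj₂ refl = ⊥-elim (p∤n d∣n)

coprime-*ˡ : ∀ {a b c} → Coprime a c → Coprime b c → Coprime (a * b) c
coprime-*ˡ a⊥c b⊥c (d∣ab , d∣c) =
  b⊥c (coprime-divisor (λ (e∣d , e∣a) → a⊥c (e∣a , ∣-trans e∣d d∣c)) d∣ab , d∣c)

coprime-^ˡ : ∀ {a c} e → Coprime a c → Coprime (a ^ e) c
coprime-^ˡ zero a⊥c (d∣1 , _) = ∣1⇒≡1 d∣1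
coprime-^ˡ (suc e) a⊥c = coprime-*ˡ a⊥c (coprime-^ˡ e a⊥c)

coprime-∣ʳ : ∀ {a b c} → Coprime a c → b ∣ c → Coprime a b
coprime-∣ʳ a⊥c b∣c (d∣a , d∣b) = a⊥c (d∣a , ∣-trans d∣b b∣c)

coprime-*-∣ : ∀ {a b c} → Coprime a b → a ∣ c → b ∣ c → a * b ∣ c
coprime-*-∣ {a} {b} a⊥b a∣c (divides q refl) =
  *-monoˡ-∣ b (coprime-divisor a⊥b (subst (a ∣_) (*-comm q b) a∣c))

prime-power-part : ∀ {p} → Prime p → ∀ n .{{_ : NonZero n}} →
  ∃₂ λ e h → n ≡ p ^ e * h × ¬ p ∣ h
prime-power-part {p} p-prime n = <-rec P step n
  where
  P : ℕ → Set
  P n = .{{NonZero n}} → ∃₂ λ e h → n ≡ p ^ e * h × ¬ p ∣ h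

  step : ∀ n → (∀ {m} → m < n → P m) → P n
  step n rec with p ∣? n
  ... | no p∤n = 0 , n , sym (*-identityˡ n) , p∤n
  ... | yes (divides m refl) =
    let instance
          _ = m*n≢0⇒m≢0 m {p}
          _ = prime⇒nonZero p-prime
        e , h , m≡ , p∤h = rec (m<m*n m p (nonTrivial⇒n>1 p {{prime⇒nonTrivial p-prime}}))
    in suc e , h , trans (cong (_* p) m≡) (lemma p (p ^ e) h) , p∤h
    where
    lemma : ∀ p x h → x * h * p ≡ p * x * h
    lemma = solve-∀

coprime-quotients : ∀ m n .{{_ : NonZero n}} →
  Coprime (quotient (gcd[m,n]∣m m n)) (quotient (gcd[m,n]∣n m n))
coprime-quotients m n {d} (d∣u , d∣v) =
  *-cancelʳ-∣ (gcd m n) {{∣⇒nonZero (gcd[m,n]∣n m n)}}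
    (subst (d * gcd m n ∣_) (sym (*-identityˡ (gcd m n)))
      (gcd-greatest (multiple (gcd[m,n]∣m m n) d∣u) (multiple (gcd[m,n]∣n m n) d∣v)))
  |> ∣1⇒≡1
  where
  multiple : ∀ {d g x} (g∣x : g ∣ x) → d ∣ quotient g∣x → d * g ∣ x
  multiple {g = g} (divides u refl) d∣u = *-monoˡ-∣ g d∣u

-- A prime `p` dividing `m / gcd m n` cannot divide the coprime quotient `n / gcd m n`. So `n`
-- contains the same power `p ^ a` as the gcd, and `m` has at least one more factor `p`.
∤⇒separating-prime : ∀ {m n} .{{_ : NonZero m}} .{{_ : NonZero n}} → ¬ m ∣ n →
  ∃ λ p → ∃₂ λ a h → Prime p × n ≡ p ^ a * h × ¬ p ∣ h × p ^ suc a ∣ m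
∤⇒separating-prime {m} {n} m∤n =
  let g = gcd m n
      g∣m = gcd[m,n]∣m m n
      g∣n = gcd[m,n]∣n m n
      u = quotient g∣m
      v = quotient g∣n
      instance
        _ = ∣⇒nonZero g∣n
        _ = quotient≢0 g∣m
      m≡ = m∣n⇒n≡quotient*m g∣m
      n≡ = m∣n⇒n≡quotient*m g∣n
      u≢1 : u ≢ 1
      u≢1 u≡1 = m∤n (subst (_∣ n) (sym (trans m≡ (trans (cong (_* g) u≡1) (*-identityˡ g)))) g∣n)
      p , p-prime , p∣u = prime-divisor u u≢1
      p∤v : ¬ p ∣ v
      p∤v p∣v = ¬prime[1] (subst Prime (coprime-quotients m n (p∣u , p∣v)) p-prime)
      a , h , g≡ , p∤h = prime-power-part p-prime g
  in p , a , h * v , p-prime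
   , trans n≡ (trans (*-comm v g) (trans (cong (_* v) g≡) (*-assoc (p ^ a) h v)))
   , (λ p∣hv → [ p∤h , p∤v ]′ (euclidsLemma h v p-prime p∣hv))
   , subst (p ^ suc a ∣_) (sym m≡) (*-pres-∣ p∣u (subst (p ^ a ∣_) (sym g≡) (m∣m*n h)))

linear-congruence : ∀ {m b} .{{_ : NonZero m}} → Coprime m b → ∀ k → ∃ λ t → m ∣ k + b * t
linear-congruence {m@(suc m′)} {b} m⊥b k with coprime-Bézout m⊥b
... | Bézout.+- x y eq = y * k , divides (x * k) (begin
  k + b * (y * k)  ≡⟨ lemma₁ k b y ⟩
  (1 + y * b) * k  ≡⟨ cong (_* k) eq ⟩
  x * m * k        ≡⟨ lemma₂ x m k ⟩
  x * k * m        ∎)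
  where
  open ≡-Reasoning
  lemma₁ : ∀ k b y → k + b * (y * k) ≡ (1 + y * b) * k
  lemma₁ = solve-∀
  lemma₂ : ∀ x m k → x * m * k ≡ x * k * m
  lemma₂ = solve-∀
-- Here `y` inverts `b` modulo `m`, and the factor `m′ = m - 1` stands for -1.
... | Bézout.-+ x y eq = y * (k * m′) , divides (k + x * k * m′) (begin
  k + b * (y * (k * m′))      ≡⟨ lemma₁ k b y m′ ⟩
  k + y * b * (k * m′)        ≡⟨ cong (λ z → k + z * (k * m′)) eq ⟨
  k + (1 + x * m) * (k * m′)  ≡⟨ lemma₂ k x m′ ⟩
  (k + x * k * m′) * m        ∎)
  where
  open ≡-Reasoning
  lemma₁ : ∀ k b y m → k + b * (y * (k * m)) ≡ k + y * b * (k * m)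
  lemma₁ = solve-∀
  lemma₂ : ∀ k x m → k + (1 + x * suc m) * (k * m) ≡ (k + x * k * m) * suc m
  lemma₂ = solve-∀

-- The prime factors of `n` are sorted by whether they divide `r`. Those that do are kept as a list,
-- so that later arguments can treat them one prime at a time.
coprime-part : ∀ r n .{{_ : NonZero n}} →
  ∃₂ λ a bs → n ≡ a * product bs × Coprime a r × All (λ p → Prime p × p ∣ r) bs
coprime-part r n with factorise n
... | record { factors = ps ; isFactorisation = refl ; factorsPrime = primes } = split primes
  where
  swap₁ : ∀ p a b → p * (a * b) ≡ a * (p * b)
  swap₁ = solve-∀
  split : ∀ {ps} → All Prime ps →
    ∃₂ λ a bs → product ps ≡ a * product bs × Coprime a r × All (λ p → Prime p × p ∣ r) bs
  split [] = 1 , [] , refl , (λ (d∣1 , _) → ∣1⇒≡1 d∣1) , []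
  split (_∷_ {p} p-prime primes) with p ∣? r | split primes
  ... | yes p∣r | a , bs , eq , a⊥r , all =
    a , p ∷ bs , trans (cong (p *_) eq) (swap₁ p a (product bs)) , a⊥r , (p-prime , p∣r) ∷ all
  ... | no p∤r | a , bs , eq , a⊥r , all =
    p * a , bs , trans (cong (p *_) eq) (sym (*-assoc p a (product bs)))
    , coprime-*ˡ (prime∧∤⇒coprime p-prime p∤r) a⊥r , all

-- Geometric sums

-- The sum 1 + d + ⋯ + d^(j-1) in Horner form, which needs no division by d - 1.
geom : ℕ → ℕ → ℕ
geom d zero = 0
geom d (suc j) = 1 + d * geom d j

^≡1+geom : ∀ r j → suc r ^ j ≡ 1 + r * geom (suc r) j
^≡1+geom r zero = cong suc (sym (*-zeroʳ r))
^≡1+geom r (suc j) = trans (cong (suc r *_) (^≡1+geom r j)) (lemma r (geom (suc r) j))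
  where
  lemma : ∀ r s → suc r * (1 + r * s) ≡ 1 + r * (1 + suc r * s)
  lemma = solve-∀

geom-+ : ∀ d i j → geom d (i + j) ≡ geom d i + d ^ i * geom d j
geom-+ d zero j = sym (+-identityʳ (geom d j))
geom-+ d (suc i) j = trans (cong (λ s → 1 + d * s) (geom-+ d i j)) (lemma d (geom d i) (d ^ i) (geom d j))
  where
  lemma : ∀ d s p t → 1 + d * (s + p * t) ≡ 1 + d * s + d * p * t
  lemma = solve-∀

-- The `l * j` terms fall into `l` blocks of length `j`, each `d ^ j` times the one before.
geom-* : ∀ d l j → geom d (l * j) ≡ geom d j * geom (d ^ j) l
geom-* d zero j = sym (*-zeroʳ (geom d j))
geom-* d (suc l) j = begin
  geom d (j + l * j)                          ≡⟨ geom-+ d j (l * j) ⟩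
  geom d j + d ^ j * geom d (l * j)           ≡⟨ cong (λ s → geom d j + d ^ j * s) (geom-* d l j) ⟩
  geom d j + d ^ j * (geom d j * geom (d ^ j) l) ≡⟨ lemma (geom d j) (d ^ j) (geom (d ^ j) l) ⟩
  geom d j * geom (d ^ j) (suc l)             ∎
  where
  open ≡-Reasoning
  lemma : ∀ s p t → s + p * (s * t) ≡ s * (1 + p * t)
  lemma = solve-∀

-- Modulo `r` the base is 1, so each of the `j` terms contributes 1.
geom≡index : ∀ {r s} → r ∣ s → ∀ j → ∃ λ z → geom (1 + s) j ≡ j + r * z
geom≡index {r} r∣s zero = 0 , sym (*-zeroʳ r)
geom≡index {r} r∣s@(divides y refl) (suc j) =
  let z , eq = geom≡index r∣s j
  in z + y * (j + r * z) , trans (cong (λ g → 1 + suc (y * r) * g) eq) (lemma r y j z)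
  where
  lemma : ∀ r y j z → 1 + suc (y * r) * (j + r * z) ≡ suc j + r * (z + y * (j + r * z))
  lemma = solve-∀

geom[^]≡index : ∀ {r s} → r ∣ s → ∀ i j → ∃ λ z → geom (suc s ^ i) j ≡ j + r * z
geom[^]≡index {r} {s} r∣s i j =
  subst (λ d → ∃ λ z → geom d j ≡ j + r * z) (sym (^≡1+geom s i))
    (geom≡index (∣m⇒∣m*n (geom (suc s) i) r∣s) j)

-- By `geom-*` the new factor is a sum of `l` powers of `suc s ^ j`, all congruent to 1 modulo `l`,
-- so `l` divides it.
∣geom-step : ∀ {l s j} → l ∣ s → j ∣ geom (suc s) j → l * j ∣ geom (suc s) (l * j)
∣geom-step {l} {s} {j} l∣s j∣ =
  let z , eq = geom[^]≡index l∣s j l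
  in subst₂ _∣_ (*-comm j l) (sym (geom-* (suc s) l j))
       (*-pres-∣ j∣ (subst (l ∣_) (sym eq) (∣m∣n⇒∣m+n ∣-refl (m∣m*n z))))

product∣geom : ∀ {s bs} → All (_∣ s) bs → product bs ∣ geom (suc s) (product bs)
product∣geom [] = 1∣ _
product∣geom (b∣s ∷ all) = ∣geom-step b∣s (product∣geom all)

^*∣geom : ∀ {p s j} e → p ∣ s → j ∣ geom (suc s) j → p ^ e * j ∣ geom (suc s) (p ^ e * j)
^*∣geom {s = s} {j} zero p∣s j∣ = subst (λ i → i ∣ geom (suc s) i) (sym (*-identityˡ j)) j∣
^*∣geom {p} {s} {j} (suc e) p∣s j∣ = subst (λ i → i ∣ geom (suc s) i) (sym (*-assoc p (p ^ e) j))
  (∣geom-step p∣s (^*∣geom e p∣s j∣))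

p∤geom : ∀ {p s j} → p ∣ s → ¬ p ∣ j → ¬ p ∣ geom (suc s) j
p∤geom {p} {s} {j} p∣s p∤j p∣g =
  let z , eq = geom≡index p∣s j
  in p∤j (∣m+n∣m⇒∣n (subst (p ∣_) (trans eq (+-comm j (p * z))) p∣g) (m∣m*n z))

-- p² ∣ s rather than p ∣ s is what makes this hold for p = 2 as well.
geom-exact : ∀ {p s j} → Prime p → p * p ∣ s → ¬ p ∣ j → ∀ e →
  ∃ λ w → geom (suc s) (p ^ e * j) ≡ p ^ e * w × ¬ p ∣ w
geom-exact {p} {s} {j} p-prime p²∣s p∤j zero =
  geom (suc s) j , trans (cong (geom (suc s)) (*-identityˡ j)) (sym (*-identityˡ _))
  , p∤geom (∣-trans (m∣m*n p) p²∣s) p∤j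
geom-exact {p} {s} {j} p-prime p²∣s p∤j (suc e) =
  let w , eq , p∤w = geom-exact p-prime p²∣s p∤j e
      i = p ^ e * j
      -- Passing from `i` to `p * i` multiplies the sum by `p + p * p * z`, which is `p` times a
      -- number congruent to 1 modulo `p`.
      z , eq′ = geom[^]≡index p²∣s i p
  in w * (1 + p * z)
   , (begin
      geom (suc s) (p * p ^ e * j)                ≡⟨ cong (geom (suc s)) (*-assoc p (p ^ e) j) ⟩
      geom (suc s) (p * i)                        ≡⟨ geom-* (suc s) p i ⟩
      geom (suc s) i * geom (suc s ^ i) p         ≡⟨ cong₂ _*_ eq eq′ ⟩
      p ^ e * w * (p + p * p * z)                 ≡⟨ lemma p (p ^ e) w z ⟩
      p * p ^ e * (w * (1 + p * z))               ∎)
   , λ p∣ → case euclidsLemma w (1 + p * z) p-prime p∣ of λ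
      { (inj₁ p∣w) → p∤w p∣w
      ; (inj₂ p∣1+) → ¬prime[1] (subst Prime (∣1⇒≡1 (∣m+n∣m⇒∣n (subst (p ∣_) (+-comm 1 (p * z)) p∣1+) (m∣m*n z))) p-prime) }
  where
  open ≡-Reasoning
  lemma : ∀ p x w z → x * w * (p + p * p * z) ≡ p * x * (w * (1 + p * z))
  lemma = solve-∀

-- Periods of affine maps modulo n

-- The j-th iterate of t ↦ k + (1 + s) t is t ↦ (1 + s)^j t + k geom (1 + s) j, so this says
-- that it has a fixed point modulo n.
HasPeriodicPoint : (s n k j : ℕ) → Set
HasPeriodicPoint s n k j = ∃ λ t → n ∣ geom (suc s) j * (k + s * t)

-- Modulo A the map t ↦ k + (1 + s) t has a fixed point, and modulo B = product bs its B-th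
-- iterate is the identity.
record Splitting (s n p P : ℕ) : Set where
  field
    c A   : ℕ
    bs    : List ℕ
    n≡    : n ≡ p ^ c * product bs * (A * P)
    A⊥s   : Coprime A s
    A≢0   : NonZero A
    bs∣s  : All (_∣ s) bs
    p∤bs  : ¬ p ∣ product bs

  bs∣geom : product bs ∣ geom (suc s) (product bs)
  bs∣geom = product∣geom bs∣s

-- With `P` taken out of `n`, all remaining factors `p` are removed first; the other primes are then
-- sorted by whether they divide `s`.
splitting : ∀ s {n p P} .{{_ : NonZero n}} → Prime p → P ∣ n → Splitting s n p P
splitting s {n} {p} {P} p-prime P∣n@(divides R n≡RP) =
  let instance
        _ = quotient≢0 P∣n
      c , N , R≡ , p∤N = prime-power-part p-prime R
      instance
        N≢0 : NonZero N
        N≢0 = ∣⇒nonZero (divides (p ^ c) R≡)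
      A , bs , N≡ , A⊥s , bs∣s = coprime-part s N
  in record
    { c = c ; A = A ; bs = bs
    ; n≡ = begin
        n                              ≡⟨ n≡RP ⟩
        R * P                          ≡⟨ cong (_* P) R≡ ⟩
        p ^ c * N * P                  ≡⟨ cong (λ m → p ^ c * m * P) N≡ ⟩
        p ^ c * (A * product bs) * P   ≡⟨ lemma (p ^ c) A (product bs) P ⟩
        p ^ c * product bs * (A * P)   ∎
    ; A⊥s = A⊥s
    ; A≢0 = ∣⇒nonZero (divides (product bs) (trans N≡ (*-comm A (product bs))))
    ; bs∣s = All.map proj₂ bs∣s
    ; p∤bs = λ p∣bs → p∤N (subst (p ∣_) (sym N≡) (∣n⇒∣m*n A p∣bs))
    }
  where
  open ≡-Reasoning
  lemma : ∀ x A B P → x * (A * B) * P ≡ x * B * (A * P)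
  lemma = solve-∀

-- The period `j` has exactly the `c` factors `p` that `n` has beyond `p ^ suc a`. The geometric sum
-- then supplies `p ^ c` and no more, so `p ^ suc a` must divide `k′ + s * t`, where it already
-- divides `s * t`.
separating-period-p² : ∀ {s n p a k} .{{_ : NonZero n}} → Prime p → p * p ∣ s →
  k ∣ s → k ∣ n → p ^ suc a ∣ k →
  ∃ λ j → HasPeriodicPoint s n k j × (∀ {k′} → HasPeriodicPoint s n k′ j → p ^ suc a ∣ k′)
separating-period-p² {s} {n} {p} {a} {k} p-prime p²∣s k∣s k∣n P∣k = j , has , only
  where
  open Splitting (splitting s p-prime (∣-trans P∣k k∣n))
  instance
    _ = A≢0
    _ = prime⇒nonZero p-prime
  P = p ^ suc a
  B = product bs
  j = p ^ c * B

  P∣s* : ∀ t → P ∣ s * t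
  P∣s* t = ∣-trans (∣-trans P∣k k∣s) (m∣m*n t)

  has : HasPeriodicPoint s n k j
  has =
    -- Only the factor `A` constrains `t`: `j` divides the geometric sum, and `p ^ suc a` divides
    -- `k + s * t` for every `t`.
    let t , A∣ = linear-congruence A⊥s k
    in t , subst (_∣ geom (suc s) j * (k + s * t)) (sym n≡)
         (*-pres-∣ (^*∣geom c (∣-trans (m∣m*n p) p²∣s) bs∣geom)
           (coprime-*-∣ (coprime-∣ʳ A⊥s (∣-trans P∣k k∣s)) A∣ (∣m∣n⇒∣m+n P∣k (P∣s* t))))

  only : ∀ {k′} → HasPeriodicPoint s n k′ j → P ∣ k′
  only {k′} (t , n∣) =
    let w , geom≡ , p∤w = geom-exact p-prime p²∣s p∤bs c
        P∣w* : P ∣ w * (k′ + s * t)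
        P∣w* = *-cancelˡ-∣ (p ^ c) {{m^n≢0 p c}} (subst (p ^ c * P ∣_)
          (trans (cong (_* (k′ + s * t)) geom≡) (*-assoc (p ^ c) w _))
          (∣-trans (divides (B * A) (trans n≡ (lemma (p ^ c) B A P))) n∣))
    in ∣m+n∣m⇒∣n (subst (P ∣_) (+-comm k′ (s * t))
         (coprime-divisor (coprime-^ˡ (suc a) (prime∧∤⇒coprime p-prime p∤w)) P∣w*)) (P∣s* t)
    where
    lemma : ∀ x B A P → x * B * (A * P) ≡ B * A * (x * P)
    lemma = solve-∀

-- Now `p` divides `s` exactly once, so `s / p` is prime to `p` and the congruence for `k` can be
-- solved modulo every power of `p`. The period can therefore be taken prime to `p`, and then `p`
-- does not divide the geometric sum.
separating-period-p : ∀ {s n p k} .{{_ : NonZero n}} → Prime p → ¬ p * p ∣ s →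
  k ∣ s → k ∣ n → p ∣ k →
  ∃ λ j → HasPeriodicPoint s n k j × (∀ {k′} → HasPeriodicPoint s n k′ j → p ∣ k′)
separating-period-p {s} {n} {p} p-prime p²∤s k∣s k∣n p∣k@(divides k₁ refl)
  with divides s₁ refl ← ∣-trans p∣k k∣s = B , has , only
  where
  open Splitting (splitting (s₁ * p) p-prime (∣-trans p∣k k∣n))
  instance
    _ = A≢0
    _ = prime⇒nonZero p-prime
  B = product bs
  p∣s : p ∣ s₁ * p
  p∣s = n∣m*n s₁

  has : HasPeriodicPoint (s₁ * p) n (k₁ * p) B
  has =
    let instance
          _ = m^n≢0 p c
          _ = m*n≢0 (p ^ c) A
        s₁-coprime : Coprime (p ^ c * A) s₁
        s₁-coprime = coprime-*ˡ
          (coprime-^ˡ c (prime∧∤⇒coprime p-prime λ p∣s₁ → p²∤s (*-monoˡ-∣ p p∣s₁)))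
          (coprime-∣ʳ A⊥s (m∣m*n p))
        t , ∣ = linear-congruence s₁-coprime k₁
    in t , subst₂ _∣_ (trans (lemma₁ (p ^ c) A B p) (sym n≡)) (cong (geom (suc (s₁ * p)) B *_) (lemma₂ k₁ s₁ t p))
         (*-pres-∣ bs∣geom (*-monoˡ-∣ p ∣))
    where
    lemma₁ : ∀ x A B p → B * (x * A * p) ≡ x * B * (A * p)
    lemma₁ = solve-∀
    lemma₂ : ∀ k s t p → (k + s * t) * p ≡ k * p + s * p * t
    lemma₂ = solve-∀

  only : ∀ {k′} → HasPeriodicPoint (s₁ * p) n k′ B → p ∣ k′
  only {k′} (t , n∣) with euclidsLemma (geom (suc (s₁ * p)) B) _ p-prime (∣-trans (∣-trans p∣k k∣n) n∣)
  ... | inj₁ p∣geom = ⊥-elim (p∤geom p∣s p∤bs p∣geom)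
  ... | inj₂ p∣ = ∣m+n∣m⇒∣n (subst (p ∣_) (+-comm k′ _) p∣) (∣-trans p∣s (m∣m*n t))

periods-determine-divisor : ∀ {s n k k′} .{{_ : NonZero n}} .{{_ : NonZero k′}} → k ∣ s → k ∣ n →
  (∀ j → HasPeriodicPoint s n k j → HasPeriodicPoint s n k′ j) → k ∣ k′
periods-determine-divisor {s} {n} {k} {k′} k∣s k∣n transfer with k ∣? k′
... | yes k∣k′ = k∣k′
... | no k∤k′
  with p , a , h , p-prime , refl , p∤h , P∣k ← ∤⇒separating-prime {{∣⇒nonZero k∣n}} k∤k′
  with p * p ∣? s
...   | yes p²∣s =
  let instance _ = prime⇒nonZero p-prime
      j , has , only = separating-period-p² {a = a} p-prime p²∣s k∣s k∣n P∣k
  in ⊥-elim (p∤h (*-cancelˡ-∣ (p ^ a) {{m^n≢0 p a}} (subst (_∣ p ^ a * h) (*-comm p (p ^ a)) (only (transfer j has)))))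
...   | no p²∤s with a
-- Two factors `p` in `k` would give `p * p ∣ s`, so only the exponent `a = 0` survives.
...     | suc b = ⊥-elim (p²∤s (∣-trans (subst (p * p ∣_) (*-assoc p p (p ^ b)) (m∣m*n (p ^ b))) (∣-trans P∣k k∣s)))
...     | zero =
  let j , has , only = separating-period-p p-prime p²∤s k∣s k∣n (∣-trans (m∣m*n 1) P∣k)
  in ⊥-elim (p∤h (subst (p ∣_) (*-identityˡ h) (only (transfer j has))))

-- A prime dividing n divides exactly one of a and the witness t.
unit-lift : ∀ {a m n} .{{_ : NonZero m}} .{{_ : NonZero n}} → Coprime a m →
  ∃ λ t → NonZero (a + m * t) × Coprime (a + m * t) n
unit-lift {a} {m} {n} a⊥m =
  let t , bs , n≡ , t⊥a , bs∣a = coprime-part a n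
      instance
        t≢0 : NonZero t
        t≢0 = ∣⇒nonZero (divides (product bs) (trans n≡ (*-comm t (product bs))))
        mt≢0 : NonZero (m * t)
        mt≢0 = m*n≢0 m t
  in t , >-nonZero (≤-trans (>-nonZero⁻¹ (m * t)) (m≤n+m (m * t) a))
   , no-common-prime⇒coprime λ {p} p-prime p∣u p∣n →
       case euclidsLemma t (product bs) p-prime (subst (p ∣_) n≡ p∣n) of λ
       { (inj₁ p∣t) → prime≢1 p-prime
           (t⊥a (p∣t , ∣m+n∣m⇒∣n (subst (p ∣_) (+-comm a (m * t)) p∣u) (∣n⇒∣m*n m p∣t)))
       ; (inj₂ p∣bs) →
           let p∣a = proj₂ (All.lookup bs∣a (factorisationHasAllPrimeFactors p-prime p∣bs (All.map proj₁ bs∣a)))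
           in case euclidsLemma m t p-prime (∣m+n∣m⇒∣n p∣u p∣a) of λ
              { (inj₁ p∣m) → prime≢1 p-prime (a⊥m (p∣a , p∣m))
              ; (inj₂ p∣t) → prime≢1 p-prime (t⊥a (p∣t , p∣a)) } }
  where
  prime≢1 : ∀ {p} → Prime p → p ≢ 1
  prime≢1 p-prime refl = ¬prime[1] p-prime

-- Bézout's identity multiplied by `t` and read modulo `n`, with multiples of `n` on both sides in
-- place of subtraction. A negative coefficient of `s` is made positive by using `n′ = n - 1` for
-- -1.
gcd-as-multiple : ∀ s n .{{_ : NonZero n}} t →
  ∃ λ x → ∃₂ λ i j → s * x + n * i ≡ gcd s n * t + n * j
gcd-as-multiple s n@(suc n′) t with Bézout.identity (gcd-GCD s n)
... | Bézout.+- x y eq = x * t , 0 , y * t , (begin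
  s * (x * t) + n * 0           ≡⟨ lemma₁ s x t n ⟩
  x * s * t                     ≡⟨ cong (_* t) eq ⟨
  (gcd s n + y * n) * t         ≡⟨ lemma₂ (gcd s n) y n t ⟩
  gcd s n * t + n * (y * t)     ∎)
  where
  open ≡-Reasoning
  lemma₁ : ∀ s x t n → s * (x * t) + n * 0 ≡ x * s * t
  lemma₁ = solve-∀
  lemma₂ : ∀ g y n t → (g + y * n) * t ≡ g * t + n * (y * t)
  lemma₂ = solve-∀
... | Bézout.-+ x y eq = x * t * n′ , y * t , x * s * t , (begin
  s * (x * t * n′) + n * (y * t)            ≡⟨ lemma₁ s x t n′ n y ⟩
  s * (x * t * n′) + y * n * t              ≡⟨ cong (λ z → s * (x * t * n′) + z * t) eq ⟨
  s * (x * t * n′) + (gcd s n + x * s) * t  ≡⟨ lemma₂ s x t n′ (gcd s n) ⟩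
  gcd s n * t + n * (x * s * t)             ∎)
  where
  open ≡-Reasoning
  lemma₁ : ∀ s x t m n y → s * (x * t * m) + n * (y * t) ≡ s * (x * t * m) + y * n * t
  lemma₁ = solve-∀
  lemma₂ : ∀ s x t m g → s * (x * t * m) + (g + x * s) * t ≡ g * t + suc m * (x * s * t)
  lemma₂ = solve-∀

-- If g generates a cyclic group of order n, this makes x ↦ g^v x^u a conjugacy from
-- x ↦ g^k x^(1+s) to x ↦ g^α x^(1+s), where k = gcd (α, s, n).
affine-normal-form : ∀ α s n .{{_ : NonZero n}} →
  ∃₂ λ u v → NonZero u × Coprime u n ×
  ∃₂ λ i j → α + s * v + n * i ≡ gcd α (gcd s n) * u + n * j
affine-normal-form α s n =
  let m = gcd s n
      k = gcd α m
      instance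
        _ = ∣⇒nonZero (gcd[m,n]∣n s n)
        _ = quotient≢0 (gcd[m,n]∣n α m)
      a = quotient (gcd[m,n]∣m α m)
      b = quotient (gcd[m,n]∣n α m)
      -- The cofactor `a` of `k` in `α` is prime to `b = m / k`, so some `a + b * t` is prime to
      -- `n`; the correction `k * b * t = m * t` is a multiple of `s` modulo `n`.
      t , u≢0 , u⊥n = unit-lift {n = n} (coprime-quotients α m)
      v , i , j , eq = gcd-as-multiple s n t
  in a + b * t , v , u≢0 , u⊥n , i , j , (begin
       α + s * v + n * i          ≡⟨ +-assoc α (s * v) (n * i) ⟩
       α + (s * v + n * i)        ≡⟨ cong (α +_) eq ⟩
       α + (m * t + n * j)        ≡⟨ cong₂ (λ x y → x + (y * t + n * j))
                                       (m∣n⇒n≡quotient*m (gcd[m,n]∣m α m)) (m∣n⇒n≡quotient*m (gcd[m,n]∣n α m)) ⟩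
       a * k + (b * k * t + n * j) ≡⟨ lemma a b k t (n * j) ⟩
       k * (a + b * t) + n * j    ∎)
  where
  open ≡-Reasoning
  lemma : ∀ a b k t z → a * k + (b * k * t + z) ≡ k * (a + b * t) + z
  lemma = solve-∀

-- Conjugacies and lists of divisors

DynEquiv-sym : ∀ {S T} {f : S → S} {g : T → T} → DynEquiv f g → DynEquiv g f
DynEquiv-sym {f = f} {g} (σ , conj) = ↔-sym σ , λ y → begin
  f (from y)                ≡⟨ strictlyInverseʳ (f (from y)) ⟨
  from (to (f (from y)))    ≡⟨ cong from (conj (from y)) ⟨
  from (g (to (from y)))    ≡⟨ cong (λ z → from (g z)) (strictlyInverseˡ y) ⟩
  from (g y)                ∎
  where
  open Inverse σ
  open ≡-Reasoning

iterate-conj : ∀ {S T : Set} (f : S → S) (g : T → T) {σ : S → T} → (∀ x → g (σ x) ≡ σ (f x)) →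
  ∀ x j → fold (σ x) g j ≡ σ (fold x f j)
iterate-conj f g conj x zero = refl
iterate-conj f g conj x (suc j) = trans (cong g (iterate-conj f g conj x j)) (conj (fold x f j))

-- This repeats the list inside `τ`, so its length is `τ m` by definition and `Fin (τ m)` indexes
-- it.
divisors : ℕ → List ℕ
divisors m = filter (_∣? m) (map suc (upTo m))

divisors-unique : ∀ m → Unique (divisors m)
divisors-unique m = Unique.filter⁺ (_∣? m) (Unique.map⁺ suc-injective (Unique.upTo⁺ m))

∈-divisors⇒∣ : ∀ {k m} → k ∈ divisors m → k ∣ m
∈-divisors⇒∣ {m = m} k∈ = proj₂ (∈-filter⁻ (_∣? m) {xs = map suc (upTo m)} k∈)

∣⇒∈-divisors : ∀ {k m} .{{_ : NonZero m}} → k ∣ m → k ∈ divisors m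
∣⇒∈-divisors {zero} {m} 0∣m = contradiction (0∣⇒≡0 0∣m) (≢-nonZero⁻¹ m)
∣⇒∈-divisors {suc k} {m} k∣m = ∈-filter⁺ (_∣? m) (∈-map⁺ suc (∈-upTo⁺ (∣⇒≤ k∣m))) k∣m

lookup-injective : ∀ {A : Set} {xs : List A} → Unique xs → ∀ {i j} → lookup xs i ≡ lookup xs j → i ≡ j
lookup-injective (_ ∷ _) {zero} {zero} _ = refl
lookup-injective (x∉ ∷ _) {zero} {suc j} eq = contradiction eq (All.lookup x∉ (∈-lookup j))
lookup-injective (x∉ ∷ _) {suc i} {zero} eq = contradiction (sym eq) (All.lookup x∉ (∈-lookup i))
lookup-injective (_ ∷ unique) {suc i} {suc j} eq = cong suc (lookup-injective unique eq)

-- The multiplicative group of a finite field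

module FieldTheory {n : ℕ} (F : FiniteField (suc n)) where

  open FiniteField F using (Carrier; 0#; 1#; 0≢1; inverse; card; isCommutativeRing)
    renaming (_+_ to _⊕_; _*_ to infixl 7 _·_; -_ to ⊖_; _^_ to infixr 8 _↑_)

  commutativeRing : CommutativeRing _ _
  commutativeRing = record { isCommutativeRing = isCommutativeRing }

  private module R = CommutativeRing commutativeRing
  open import Algebra.Properties.CommutativeSemigroup R.*-commutativeSemigroup using (interchange)

  ↑-+ : ∀ x i j → x ↑ (i + j) ≡ x ↑ i · x ↑ j
  ↑-+ x zero j = sym (R.*-identityˡ (x ↑ j))
  ↑-+ x (suc i) j = trans (cong (x ·_) (↑-+ x i j)) (sym (R.*-assoc x (x ↑ i) (x ↑ j)))

  ↑-* : ∀ x i j → x ↑ (i * j) ≡ (x ↑ i) ↑ j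
  ↑-* x i zero = cong (x ↑_) (*-zeroʳ i)
  ↑-* x i (suc j) = trans (cong (x ↑_) (*-suc i j)) (trans (↑-+ x i (i * j)) (cong (x ↑ i ·_) (↑-* x i j)))

  1↑ : ∀ i → 1# ↑ i ≡ 1#
  1↑ zero = refl
  1↑ (suc i) = trans (R.*-identityˡ (1# ↑ i)) (1↑ i)

  ·-↑ : ∀ x y i → (x · y) ↑ i ≡ x ↑ i · y ↑ i
  ·-↑ x y zero = sym (R.*-identityˡ 1#)
  ·-↑ x y (suc i) = trans (cong (x · y ·_) (·-↑ x y i)) (interchange x y (x ↑ i) (y ↑ i))

  0↑ : ∀ i .{{_ : NonZero i}} → 0# ↑ i ≡ 0#
  0↑ (suc i) = R.zeroˡ (0# ↑ i)

  ∣⇒↑≡1 : ∀ x i {j} → x ↑ i ≡ 1# → i ∣ j → x ↑ j ≡ 1#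
  ∣⇒↑≡1 x i x↑i≡1 (divides r refl) =
    trans (cong (x ↑_) (*-comm r i)) (trans (↑-* x i r) (trans (cong (_↑ r) x↑i≡1) (1↑ r)))

  ·-cancelˡ : ∀ {x y z} → x ≢ 0# → x · y ≡ x · z → y ≡ z
  ·-cancelˡ {x} {y} {z} x≢0 xy≡xz =
    let x⁻¹ , xx⁻¹≡1 = inverse x x≢0
        undo : ∀ w → x⁻¹ · (x · w) ≡ w
        undo w = trans (sym (R.*-assoc x⁻¹ x w))
          (trans (cong (_· w) (trans (R.*-comm x⁻¹ x) xx⁻¹≡1)) (R.*-identityˡ w))
    in trans (sym (undo y)) (trans (cong (x⁻¹ ·_) xy≡xz) (undo z))

  ·-nonzero : ∀ {x y} → x ≢ 0# → y ≢ 0# → x · y ≢ 0#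
  ·-nonzero {x} x≢0 y≢0 xy≡0 = y≢0 (·-cancelˡ x≢0 (trans xy≡0 (sym (R.zeroʳ x))))

  ↑-nonzero : ∀ {x} → x ≢ 0# → ∀ i → x ↑ i ≢ 0#
  ↑-nonzero x≢0 zero 1≡0 = 0≢1 (sym 1≡0)
  ↑-nonzero x≢0 (suc i) = ·-nonzero x≢0 (↑-nonzero x≢0 i)

  ↑-+-cancel : ∀ {x} → x ≢ 0# → ∀ i j → x ↑ (i + j) ≡ x ↑ i → x ↑ j ≡ 1#
  ↑-+-cancel {x} x≢0 i j eq = ·-cancelˡ (↑-nonzero x≢0 i)
    (trans (sym (↑-+ x i j)) (trans eq (sym (R.*-identityʳ (x ↑ i)))))

  open Inverse card using (to; from) renaming (strictlyInverseˡ to to-from; strictlyInverseʳ to from-to)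

  from-injective : ∀ {x y} → from x ≡ from y → x ≡ y
  from-injective {x} {y} eq = trans (sym (to-from x)) (trans (cong to eq) (to-from y))

  to-injective : ∀ {i j} → to i ≡ to j → i ≡ j
  to-injective {i} {j} eq = trans (sym (from-to i)) (trans (cong from eq) (from-to j))

  infix 4 _≟ᶠ_
  _≟ᶠ_ : DecidableEquality Carrier
  x ≟ᶠ y = map′ from-injective (cong from) (from x Fin.≟ from y)

  -- Deleting the position of `0#` from `Fin (suc n)` numbers the nonzero elements by `Fin n`;
  -- `unit` reads the numbering backwards.
  index : ∀ x → x ≢ 0# → Fin n
  index x x≢0 = punchOut {i = from 0#} {j = from x} λ eq → x≢0 (sym (from-injective eq))

  index-injective : ∀ {x y} (x≢0 : x ≢ 0#) (y≢0 : y ≢ 0#) → index x x≢0 ≡ index y y≢0 → x ≡ y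
  index-injective x≢0 y≢0 eq = from-injective (punchOut-injective {i = from 0#} _ _ eq)

  unit : Fin n → Carrier
  unit i = to (punchIn (from 0#) i)

  unit-nonzero : ∀ i → unit i ≢ 0#
  unit-nonzero i eq = punchInᵢ≢i (from 0#) i (trans (sym (from-to _)) (cong from eq))

  unit-injective : Injective _≡_ _≡_ unit
  unit-injective eq = punchIn-injective (from 0#) _ _ (to-injective eq)

  unit-index : ∀ x (x≢0 : x ≢ 0#) → unit (index x x≢0) ≡ x
  unit-index x x≢0 = trans (cong to (Fin.punchIn-punchOut _)) (to-from x)

  -- Monic polynomials and their roots

  data Monic : ℕ → (Carrier → Carrier) → Set where
    one  : ∀ {f} → (∀ x → f x ≡ 1#) → Monic 0 f
    step : ∀ {m f g} c → Monic m g → (∀ x → f x ≡ x · g x ⊕ c) → Monic (suc m) f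

  ↑-monic : ∀ m → Monic m (_↑ m)
  ↑-monic zero = one λ _ → refl
  ↑-monic (suc m) = step 0# (↑-monic m) λ x → sym (R.+-identityʳ _)

  open import Algebra.Solver.Ring.NaturalCoefficients.Default R.commutativeSemiring
    using (solve; _:=_; _:+_; _:*_; con)

  -- f (x) − f (r) = (x − r) h (x), with both sides moved so that no subtraction occurs.
  factor : ∀ {m f} → Monic (suc m) f → ∀ r →
    ∃ λ h → Monic m h × ∀ x → f x ⊕ r · h x ≡ x · h x ⊕ f r
  factor {f = f} (step {g = g} c (one g≡1) f≡) r = g , one g≡1 , λ x → begin
    f x ⊕ r · g x            ≡⟨ cong (_⊕ r · g x) (f≡ x) ⟩
    x · g x ⊕ c ⊕ r · g x    ≡⟨ cong (λ y → x · g x ⊕ c ⊕ r · y) (trans (g≡1 x) (sym (g≡1 r))) ⟩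
    x · g x ⊕ c ⊕ r · g r    ≡⟨ solve 3 (λ a c b → a :+ c :+ b := a :+ (b :+ c)) refl (x · g x) c (r · g r) ⟩
    x · g x ⊕ (r · g r ⊕ c)  ≡⟨ cong (x · g x ⊕_) (f≡ r) ⟨
    x · g x ⊕ f r            ∎
    where open ≡-Reasoning
  factor {f = f} (step {g = g} c g-monic@(step _ _ _) f≡) r =
    let h , h-monic , eq = factor g-monic r
        h′ = λ x → x · h x ⊕ g r
    in h′ , step (g r) h-monic (λ _ → refl) , λ x → begin
    f x ⊕ r · h′ x                       ≡⟨ cong (_⊕ r · h′ x) (f≡ x) ⟩
    x · g x ⊕ c ⊕ r · h′ x               ≡⟨ solve 6 (λ x gx c r hx gr →
                                              x :* gx :+ c :+ r :* (x :* hx :+ gr)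
                                              := x :* (gx :+ r :* hx) :+ (r :* gr :+ c))
                                              refl x (g x) c r (h x) (g r) ⟩
    x · (g x ⊕ r · h x) ⊕ (r · g r ⊕ c)  ≡⟨ cong₂ (λ y z → x · y ⊕ z) (eq x) (sym (f≡ r)) ⟩
    x · h′ x ⊕ f r                       ∎
    where open ≡-Reasoning

  -- Dividing out the root `r = ρ zero` leaves a quotient `h` of smaller degree. If `h` did not
  -- vanish at another root `x`, then `x · h x ≡ r · h x` would cancel to `x ≡ r`, against
  -- injectivity.
  roots≤degree : ∀ {m k f} → Monic m f → (ρ : Fin k → Carrier) → Injective _≡_ _≡_ ρ →
    (∀ i → f (ρ i) ≡ 0#) → k ≤ m
  roots≤degree {k = zero} _ _ _ _ = z≤n
  roots≤degree {k = suc k} (one f≡1) ρ _ root = ⊥-elim (0≢1 (trans (sym (root zero)) (f≡1 (ρ zero))))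
  roots≤degree {suc m} {suc k} {f} f-monic@(step _ _ _) ρ ρ-injective root =
    let r = ρ zero
        h , h-monic , eq = factor f-monic r
        h-root : ∀ i → h (ρ (suc i)) ≡ 0#
        h-root i = case h (ρ (suc i)) ≟ᶠ 0# of λ
          { (yes h≡0) → h≡0
          ; (no h≢0) → let x = ρ (suc i) in
              contradiction
                (ρ-injective (·-cancelˡ h≢0 (begin
                  h x · r          ≡⟨ R.*-comm (h x) r ⟩
                  r · h x          ≡⟨ R.+-identityˡ (r · h x) ⟨
                  0# ⊕ r · h x     ≡⟨ cong (_⊕ r · h x) (root (suc i)) ⟨
                  f x ⊕ r · h x    ≡⟨ eq x ⟩
                  x · h x ⊕ f r    ≡⟨ cong (x · h x ⊕_) (root zero) ⟩
                  x · h x ⊕ 0#     ≡⟨ R.+-identityʳ (x · h x) ⟩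
                  x · h x          ≡⟨ R.*-comm x (h x) ⟩
                  h x · x          ∎)))
                λ () }
    in s≤s (roots≤degree h-monic (ρ ∘ suc) (Fin.suc-injective ∘ ρ-injective) h-root)
    where open ≡-Reasoning

  -- Orders of elements and existence of a generator

  record HasOrder (x : Carrier) (a : ℕ) : Set where
    field
      a≢0     : NonZero a
      ↑a≡1    : x ↑ a ≡ 1#
      minimal : ∀ j → x ↑ j ≡ 1# → a ∣ j

    multiple : ∀ {j} → a ∣ j → x ↑ j ≡ 1#
    multiple = ∣⇒↑≡1 x a ↑a≡1

    nonzero : x ≢ 0#
    nonzero refl = 0≢1 (trans (sym (0↑ a {{a≢0}})) ↑a≡1)

    ↑-injective-≤ : ∀ {i j} → i ≤ j → j < a → x ↑ i ≡ x ↑ j → i ≡ j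
    ↑-injective-≤ {i} i≤j j<a eq with m≤n⇒∃[o]m+o≡n i≤j
    ... | zero , refl = sym (+-identityʳ i)
    ... | suc d , refl = contradiction (∣⇒≤ (minimal (suc d) (↑-+-cancel nonzero i (suc d) (sym eq))))
                           (<⇒≱ (≤-<-trans (m≤n+m (suc d) i) j<a))

    ↑-injective : ∀ {i j : Fin a} → x ↑ toℕ i ≡ x ↑ toℕ j → i ≡ j
    ↑-injective {i} {j} eq with ≤-total (toℕ i) (toℕ j)
    ... | inj₁ i≤j = toℕ-injective (↑-injective-≤ i≤j (toℕ<n j) eq)
    ... | inj₂ j≤i = sym (toℕ-injective (↑-injective-≤ j≤i (toℕ<n i) (sym eq)))

    order≤n : a ≤ n
    order≤n = injective⇒≤ {f = λ i → index (x ↑ toℕ i) (↑-nonzero nonzero (toℕ i))}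
      λ {i} {j} eq → ↑-injective (index-injective (↑-nonzero nonzero (toℕ i)) (↑-nonzero nonzero (toℕ j)) eq)

  open HasOrder

  opaque
    -- Two of the first `n + 1` powers coincide because there are only `n` units, which gives a
    -- positive exponent. Descent reaches a least one, and by division with remainder it divides all
    -- others.
    finite-order : ∀ {x} → x ≢ 0# → ∃ (HasOrder x)
    finite-order {x} x≢0 =
      let x↑≢0 = λ (i : Fin (suc n)) → ↑-nonzero x≢0 (toℕ i)
          i , j , i<j , eq = pigeonhole (n<1+n n) (λ i → index (x ↑ toℕ i) (x↑≢0 i))
          d , i+1+d≡j = m≤n⇒∃[o]m+o≡n i<j
      in least (suc d) (↑-+-cancel x≢0 (toℕ i) (suc d)
           (trans (cong (x ↑_) (trans (+-suc (toℕ i) d) i+1+d≡j)) (sym (index-injective (x↑≢0 i) (x↑≢0 j) eq))))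
      where
      least : ∀ a .{{_ : NonZero a}} → x ↑ a ≡ 1# → ∃ (HasOrder x)
      least a = <-rec P descend a
        where
        P : ℕ → Set
        P a = .{{NonZero a}} → x ↑ a ≡ 1# → ∃ (HasOrder x)

        descend : ∀ a → (∀ {b} → b < a → P b) → P a
        descend a@(suc _) smaller x↑a≡1
          with any? (λ (b : Fin a) → ¬? (toℕ b ≟ 0) ×-dec (x ↑ toℕ b ≟ᶠ 1#))
        ... | yes (b , b≢0 , x↑b≡1) = smaller (toℕ<n b) {{≢-nonZero b≢0}} x↑b≡1
        ... | no none = a , record
          { a≢0 = _
          ; ↑a≡1 = x↑a≡1
          ; minimal = λ j x↑j≡1 → m%n≡0⇒n∣m j a (remainder≡0 j x↑j≡1)
          }
          where
          remainder≡0 : ∀ j → x ↑ j ≡ 1# → j % a ≡ 0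
          remainder≡0 j x↑j≡1 with j % a ≟ 0
          ... | yes r≡0 = r≡0
          ... | no r≢0 = contradiction
            ( fromℕ< (m%n<n j a)
            , r≢0 ∘ trans (sym (toℕ-fromℕ< (m%n<n j a)))
            , (begin
                x ↑ toℕ (fromℕ< (m%n<n j a))      ≡⟨ cong (x ↑_) (toℕ-fromℕ< (m%n<n j a)) ⟩
                x ↑ (j % a)                       ≡⟨ R.*-identityʳ _ ⟨
                x ↑ (j % a) · 1#                  ≡⟨ cong (x ↑ (j % a) ·_) (∣⇒↑≡1 x a x↑a≡1 (n∣m*n (j / a))) ⟨
                x ↑ (j % a) · x ↑ (j / a * a)     ≡⟨ ↑-+ x (j % a) _ ⟨
                x ↑ (j % a + j / a * a)           ≡⟨ cong (x ↑_) (m≡m%n+[m/n]*n j a) ⟨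
                x ↑ j                             ≡⟨ x↑j≡1 ⟩
                1#                                ∎))
            none
            where open ≡-Reasoning

  order-↑ : ∀ {x} r {a} → HasOrder x (r * a) → HasOrder (x ↑ r) a
  order-↑ {x} r {a} ord = record
    { a≢0 = m*n≢0⇒n≢0 r {{a≢0 ord}}
    ; ↑a≡1 = trans (sym (↑-* x r a)) (↑a≡1 ord)
    ; minimal = λ j eq → *-cancelˡ-∣ r {{m*n≢0⇒m≢0 r {{a≢0 ord}}}} (minimal ord (r * j) (trans (↑-* x r j) eq))
    }

  -- Raising `(x · y) ↑ j ≡ 1#` to the power `b` removes `y`, so `a ∣ b * j` and hence `a ∣ j`;
  -- likewise with the roles exchanged.
  order-· : ∀ {x y a b} → HasOrder x a → HasOrder y b → Coprime a b → HasOrder (x · y) (a * b)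
  order-· {x} {y} {a} {b} ord-x ord-y a⊥b = record
    { a≢0 = m*n≢0 a b {{a≢0 ord-x}} {{a≢0 ord-y}}
    ; ↑a≡1 = begin
        (x · y) ↑ (a * b)            ≡⟨ ·-↑ x y (a * b) ⟩
        x ↑ (a * b) · y ↑ (a * b)    ≡⟨ cong₂ _·_ (multiple ord-x (m∣m*n b)) (multiple ord-y (n∣m*n a)) ⟩
        1# · 1#                      ≡⟨ R.*-identityˡ 1# ⟩
        1#                           ∎
    ; minimal = λ j eq → coprime-*-∣ a⊥b
        (divides-exponent j ord-x ord-y a⊥b eq)
        (divides-exponent j ord-y ord-x (Coprimality.sym a⊥b) (trans (cong (_↑ j) (R.*-comm y x)) eq))
    }
    where
    open ≡-Reasoning
    divides-exponent : ∀ {x y a b} j → HasOrder x a → HasOrder y b → Coprime a b →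
      (x · y) ↑ j ≡ 1# → a ∣ j
    divides-exponent {x} {y} {a} {b} j ord-x ord-y a⊥b eq =
      coprime-divisor a⊥b (minimal ord-x (b * j) (begin
        x ↑ (b * j)                  ≡⟨ R.*-identityʳ _ ⟨
        x ↑ (b * j) · 1#             ≡⟨ cong (x ↑ (b * j) ·_) (multiple ord-y (m∣m*n j)) ⟨
        x ↑ (b * j) · y ↑ (b * j)    ≡⟨ ·-↑ x y (b * j) ⟨
        (x · y) ↑ (b * j)            ≡⟨ ∣⇒↑≡1 (x · y) j eq (n∣m*n b) ⟩
        1#                           ∎))

  opaque
    -- The order `b` of `x` does not divide `a`, so some `p ^ suc e` divides `b` while
    -- `a = p ^ e * h` with `h` prime to `p`. Then `g ↑ (p ^ e)` has order `h`, a power of `x` has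
    -- order `p ^ suc e`, and their product has order `a * p`.
    larger-order : ∀ {g a x} → HasOrder g a → x ≢ 0# → x ↑ a ≢ 1# →
      ∃₂ λ g′ a′ → HasOrder g′ a′ × a < a′
    larger-order {g} {a} {x} ord-g x≢0 x↑a≢1
      with b , ord-x ← finite-order x≢0
      with p , e , h , p-prime , refl , p∤h , divides r refl ←
        ∤⇒separating-prime {{a≢0 ord-x}} {{a≢0 ord-g}} (λ b∣a → x↑a≢1 (multiple ord-x b∣a))
      = _ , _
      , order-· (order-↑ (p ^ e) ord-g) (order-↑ r ord-x)
          (Coprimality.sym (coprime-^ˡ (suc e) (prime∧∤⇒coprime p-prime p∤h)))
      , subst (p ^ e * h <_) (lemma p (p ^ e) h)
          (m<m*n (p ^ e * h) p {{a≢0 ord-g}} (nonTrivial⇒n>1 p {{prime⇒nonTrivial p-prime}}))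
      where
      lemma : ∀ p x h → x * h * p ≡ h * (p * x)
      lemma = solve-∀

  HasExponent : ℕ → Set
  HasExponent a = ∀ {x} → x ≢ 0# → x ↑ a ≡ 1#

  opaque
    maximal-order : ∃₂ λ g a → HasOrder g a × HasExponent a
    maximal-order = climb n 1# 1 (record
      { a≢0 = _ ; ↑a≡1 = 1↑ 1 ; minimal = λ j _ → 1∣ j }) (m≤n+m n 1)
      where
      -- Orders increase strictly and are at most `n`, so `fuel` only has to cover the gap `n - a`.
      climb : ∀ fuel g a → HasOrder g a → n ≤ a + fuel → ∃₂ λ g a → HasOrder g a × HasExponent a
      climb fuel g a ord n≤ with any? (λ i → ¬? (unit i ↑ a ≟ᶠ 1#))
      ... | no none = g , a , ord , λ {x} x≢0 → decidable-stable (x ↑ a ≟ᶠ 1#) λ x↑a≢1 →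
        none (index x x≢0 , x↑a≢1 ∘ trans (cong (_↑ a) (sym (unit-index x x≢0))))
      ... | yes (i , unit↑a≢1) with g′ , a′ , ord′ , a<a′ ← larger-order ord (unit-nonzero i) unit↑a≢1 with fuel
      ...   | zero = contradiction (order≤n ord′)
                       (<⇒≱ (≤-<-trans (subst (n ≤_) (+-identityʳ a) n≤) a<a′))
      ...   | suc fuel = climb fuel g′ a′ ord′
                           (≤-trans n≤ (subst (_≤ a′ + fuel) (sym (+-suc a fuel)) (+-monoˡ-≤ fuel a<a′)))

  -- Each of the `n` units is a root of X^a - 1.
  exponent≥n : ∀ {a} .{{_ : NonZero a}} → HasExponent a → n ≤ a
  exponent≥n {suc a} exponent = roots≤degree
    (step {f = λ x → x ↑ suc a ⊕ ⊖ 1#} (⊖ 1#) (↑-monic a) λ _ → refl)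
    unit unit-injective
    λ i → trans (cong (_⊕ ⊖ 1#) (exponent (unit-nonzero i))) (R.-‿inverseʳ 1#)

  opaque
    generator : ∃ λ g → HasOrder g n × HasExponent n
    generator with g , a , ord , exponent ← maximal-order
      with refl ← ≤-antisym (order≤n ord) (exponent≥n {{a≢0 ord}} exponent) = g , ord , exponent

  -- Monomial systems

  module Dynamics (g : Carrier) (ord : HasOrder g n) (exponent : HasExponent n) where

    instance
      n≢0 : NonZero n
      n≢0 = a≢0 ord

    g↑≢0 : ∀ t → g ↑ t ≢ 0#
    g↑≢0 = ↑-nonzero (nonzero ord)

    -- The `n` powers of `g` are distinct units; a missing `x` would make `n + 1` distinct units
    -- among `n`.
    discrete-log : ∀ {x} → x ≢ 0# → ∃ λ t → x ≡ g ↑ t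
    discrete-log {x} x≢0 with any? (λ (t : Fin n) → x ≟ᶠ g ↑ toℕ t)
    ... | yes (t , x≡) = toℕ t , x≡
    ... | no none = ⊥-elim (collision (pigeonhole (n<1+n n) (λ i → index (element i) (element≢0 i))))
      where
      element : Fin (suc n) → Carrier
      element zero = x
      element (suc t) = g ↑ toℕ t

      element≢0 : ∀ i → element i ≢ 0#
      element≢0 zero = x≢0
      element≢0 (suc t) = g↑≢0 (toℕ t)

      collision : ¬ (∃₂ λ i j → i Fin.< j × index (element i) (element≢0 i) ≡ index (element j) (element≢0 j))
      collision (zero , suc t , _ , eq) = none (t , index-injective x≢0 (g↑≢0 (toℕ t)) eq)
      collision (suc i , suc j , s≤s i<j , eq) =
        <⇒≢ i<j (cong toℕ (↑-injective ord (index-injective (g↑≢0 (toℕ i)) (g↑≢0 (toℕ j)) eq)))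

    system : ℕ → ℕ → Carrier → Carrier
    system s k = monomial F (g ↑ k) (suc s)

    g↑-cong : ∀ {a b} i j → a + n * i ≡ b + n * j → g ↑ a ≡ g ↑ b
    g↑-cong {a} {b} i j eq = trans (drop a i) (trans (cong (g ↑_) eq) (sym (drop b j)))
      where
      drop : ∀ a i → g ↑ a ≡ g ↑ (a + n * i)
      drop a i = sym (trans (↑-+ g a (n * i))
        (trans (cong (g ↑ a ·_) (multiple ord (m∣m*n i))) (R.*-identityʳ (g ↑ a))))

    system-g↑ : ∀ s k t → system s k (g ↑ t) ≡ g ↑ (k + t * suc s)
    system-g↑ s k t = trans (cong (g ↑ k ·_) (sym (↑-* g t (suc s)))) (sym (↑-+ g k (t * suc s)))

    -- In exponents the first step moves `t` by `k + s * t`, and each further step multiplies the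
    -- displacement by `suc s`, so the displacements add up to a geometric sum.
    iterate-g↑ : ∀ s k t j → fold (g ↑ t) (system s k) j ≡ g ↑ (t + geom (suc s) j * (k + s * t))
    iterate-g↑ s k t zero = cong (g ↑_) (sym (+-identityʳ t))
    iterate-g↑ s k t (suc j) = trans (cong (system s k) (iterate-g↑ s k t j))
      (trans (system-g↑ s k (t + geom (suc s) j * (k + s * t))) (cong (g ↑_) (lemma s k t (geom (suc s) j))))
      where
      lemma : ∀ s k t G → k + (t + G * (k + s * t)) * suc s ≡ t + (1 + suc s * G) * (k + s * t)
      lemma = solve-∀

    iterate-0 : ∀ s k j → fold 0# (system s k) j ≡ 0#
    iterate-0 s k zero = refl
    iterate-0 s k (suc j) = trans (cong (system s k) (iterate-0 s k j))
      (trans (cong (g ↑ k ·_) (0↑ (suc s))) (R.zeroʳ (g ↑ k)))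

    periodic⇒exponent : ∀ s k j {y} → y ≢ 0# → fold y (system s k) j ≡ y → HasPeriodicPoint s n k j
    periodic⇒exponent s k j y≢0 fixed with t , refl ← discrete-log y≢0 =
      let E = geom (suc s) j * (k + s * t)
      in t , minimal ord E (↑-+-cancel (nonzero ord) t E (trans (sym (iterate-g↑ s k t j)) fixed))

    exponent⇒periodic : ∀ s k j → HasPeriodicPoint s n k j →
      ∃ λ y → y ≢ 0# × fold y (system s k) j ≡ y
    exponent⇒periodic s k j (t , divides c eq) = g ↑ t , g↑≢0 t
      , trans (iterate-g↑ s k t j) (g↑-cong 0 c
          (trans (cong₂ _+_ (cong (t +_) (trans eq (*-comm c n))) (*-zeroʳ n)) (+-identityʳ _)))

    -- 0 is always fixed, but a conjugacy need not fix it; of two distinct points at least one is a unit.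
    transfer-period : ∀ s k k′ → DynEquiv (system s k) (system s k′) →
      ∀ j → HasPeriodicPoint s n k j → HasPeriodicPoint s n k′ j
    transfer-period s k k′ (σ , conj) j has
      with y , y≢0 , y-fixed ← exponent⇒periodic s k j has
      with Inverse.to σ y ≟ᶠ 0#
    ... | no σy≢0 = periodic⇒exponent s k′ j σy≢0
      (trans (iterate-conj (system s k) (system s k′) conj y j) (cong (Inverse.to σ) y-fixed))
    ... | yes σy≡0 = periodic⇒exponent s k′ j σ0≢0
      (trans (iterate-conj (system s k) (system s k′) conj 0# j) (cong (Inverse.to σ) (iterate-0 s k j)))
      where
      σ0≢0 : Inverse.to σ 0# ≢ 0#
      σ0≢0 σ0≡0 = y≢0 (trans (sym (Inverse.strictlyInverseʳ σ y))
        (trans (cong (Inverse.from σ) (trans σy≡0 (sym σ0≡0))) (Inverse.strictlyInverseʳ σ 0#)))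

    equivalent⇒∣ : ∀ s {k k′} → k ∣ gcd s n → k′ ∣ gcd s n →
      DynEquiv (system s k) (system s k′) → k ∣ k′
    equivalent⇒∣ s {k} {k′} k∣ k′∣ equiv =
      periods-determine-divisor {{it}} {{∣⇒nonZero (∣-trans k′∣ (gcd[m,n]∣n s n))}}
        (∣-trans k∣ (gcd[m,n]∣m s n)) (∣-trans k∣ (gcd[m,n]∣n s n))
        (transfer-period s k k′ equiv)

    ↑-root : ∀ {u} .{{_ : NonZero u}} → Coprime u n → ∃ λ w → ∀ x → x ↑ (u * w) ≡ x
    ↑-root {u} u⊥n =
      -- `pred n` stands for -1, so `t` is an inverse of `u` modulo `n`.
      let t , n∣ = linear-congruence (Coprimality.sym u⊥n) (pred n)
          instance
            _ = >-nonZero (≤-trans (>-nonZero⁻¹ n) (m≤n+m n t))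
            _ = m*n≢0 u (t + n)
      -- Adding `n` makes the exponent positive, so that `0#` is sent to itself as well.
      in t + n , λ x → case x ≟ᶠ 0# of λ
        { (yes refl) → 0↑ (u * (t + n))
        ; (no x≢0) → begin
            x ↑ (u * (t + n))            ≡⟨ cong (x ↑_) (*-distribˡ-+ u t n) ⟩
            x ↑ (u * t + u * n)          ≡⟨ ↑-+ x (u * t) (u * n) ⟩
            x ↑ (u * t) · x ↑ (u * n)    ≡⟨ cong (x ↑ (u * t) ·_) (∣⇒↑≡1 x n (exponent x≢0) (n∣m*n u)) ⟩
            x ↑ (u * t) · 1#             ≡⟨ R.*-identityʳ _ ⟩
            x ↑ (u * t)                  ≡⟨ ·-cancelˡ (↑-nonzero x≢0 (pred n)) (begin
              x ↑ pred n · x ↑ (u * t)     ≡⟨ ↑-+ x (pred n) (u * t) ⟨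
              x ↑ (pred n + u * t)         ≡⟨ ∣⇒↑≡1 x n (exponent x≢0) n∣ ⟩
              1#                           ≡⟨ exponent x≢0 ⟨
              x ↑ n                        ≡⟨ cong (x ↑_) (suc-pred n) ⟨
              x · x ↑ pred n               ≡⟨ R.*-comm x _ ⟩
              x ↑ pred n · x               ∎) ⟩
            x                            ∎ }
      where open ≡-Reasoning

    -- The inverse map divides by `g ↑ v` and takes the `u`-th root, which is the `w`-th power with
    -- `w` from `↑-root`.
    scaled-power : ∀ {u} .{{_ : NonZero u}} → Coprime u n → ∀ v → Σ (Carrier ↔ Carrier) λ σ →
      ∀ x → Inverse.to σ x ≡ g ↑ v · x ↑ u
    scaled-power {u} u⊥n v =
      let w , root = ↑-root u⊥n
          c , g↑v·c≡1 = inverse (g ↑ v) (g↑≢0 v)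
          undo : ∀ x y → x · y ≡ 1# → ∀ z → x · (y · z) ≡ z
          undo x y xy≡1 z = trans (sym (R.*-assoc x y z)) (trans (cong (_· z) xy≡1) (R.*-identityˡ z))
      in mk↔ₛ′ (λ x → g ↑ v · x ↑ u) (λ y → (c · y) ↑ w)
           (λ y → trans
             (cong (g ↑ v ·_) (trans (sym (↑-* (c · y) w u)) (trans (cong ((c · y) ↑_) (*-comm w u)) (root (c · y)))))
             (undo (g ↑ v) c g↑v·c≡1 y))
           (λ x → trans
             (cong (_↑ w) (undo c (g ↑ v) (trans (R.*-comm c (g ↑ v)) g↑v·c≡1) (x ↑ u)))
             (trans (sym (↑-* x u w)) (root x)))
       , λ _ → refl

    equivalent-to-divisor : ∀ s α → DynEquiv (system s α) (system s (gcd α (gcd s n)))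
    equivalent-to-divisor s α =
      let u , v , u≢0 , u⊥n , i , j , eq = affine-normal-form α s n
          σ , σ≡ = scaled-power {{u≢0}} u⊥n v
          k = gcd α (gcd s n)
          d = suc s
      in DynEquiv-sym (σ , λ x → begin
        g ↑ α · Inverse.to σ x ↑ d             ≡⟨ cong (λ y → g ↑ α · y ↑ d) (σ≡ x) ⟩
        g ↑ α · (g ↑ v · x ↑ u) ↑ d            ≡⟨ cong (g ↑ α ·_) (·-↑ (g ↑ v) (x ↑ u) d) ⟩
        g ↑ α · ((g ↑ v) ↑ d · (x ↑ u) ↑ d)    ≡⟨ R.*-assoc _ _ _ ⟨
        g ↑ α · (g ↑ v) ↑ d · (x ↑ u) ↑ d      ≡⟨ cong₂ _·_
          (trans (cong (g ↑ α ·_) (sym (↑-* g v d))) (sym (↑-+ g α (v * d))))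
          (trans (sym (↑-* x u d)) (trans (cong (x ↑_) (*-comm u d)) (↑-* x d u))) ⟩
        -- As `d = 1 + s`, adding `v` to `α + s * v ≡ k * u` modulo `n` gives
        -- `α + v * d ≡ v + k * u`.
        g ↑ (α + v * d) · (x ↑ d) ↑ u          ≡⟨ cong (_· (x ↑ d) ↑ u) (g↑-cong i j
          (trans (lemma₁ α v s (n * i)) (trans (cong (v +_) eq) (lemma₂ v (k * u) (n * j))))) ⟩
        g ↑ (v + k * u) · (x ↑ d) ↑ u          ≡⟨ cong (_· (x ↑ d) ↑ u) (trans (↑-+ g v (k * u)) (cong (g ↑ v ·_) (↑-* g k u))) ⟩
        g ↑ v · (g ↑ k) ↑ u · (x ↑ d) ↑ u      ≡⟨ R.*-assoc _ _ _ ⟩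
        g ↑ v · ((g ↑ k) ↑ u · (x ↑ d) ↑ u)    ≡⟨ cong (g ↑ v ·_) (·-↑ (g ↑ k) (x ↑ d) u) ⟨
        g ↑ v · (g ↑ k · x ↑ d) ↑ u            ≡⟨ σ≡ _ ⟨
        Inverse.to σ (g ↑ k · x ↑ d)           ∎)
      where
      open ≡-Reasoning
      lemma₁ : ∀ α v s z → α + v * suc s + z ≡ v + (α + s * v + z)
      lemma₁ = solve-∀
      lemma₂ : ∀ v x z → v + (x + z) ≡ v + x + z
      lemma₂ = solve-∀

    -- The representatives are `g ↑ k` for the divisors `k` of `gcd s n`. Equivalent ones have
    -- exponents dividing each other, and any `g ↑ α` is equivalent to the one with exponent
    -- `gcd α (gcd s n)`.
    classes : ∀ s → HasNClasses {FiniteField.Units F}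
      (λ a b → DynEquiv (monomial F (proj₁ a) (suc s)) (monomial F (proj₁ b) (suc s)))
      (τ (gcd s n))
    classes s = representative , distinct , complete
      where
      m = gcd s n
      instance
        m≢0 : NonZero m
        m≢0 = ∣⇒nonZero (gcd[m,n]∣n s n)

      divisor : Fin (τ m) → ℕ
      divisor = lookup (divisors m)

      divisor∣m : ∀ i → divisor i ∣ m
      divisor∣m i = ∈-divisors⇒∣ (∈-lookup i)

      representative : Fin (τ m) → FiniteField.Units F
      representative i = g ↑ divisor i , g↑≢0 (divisor i)

      distinct : ∀ i j → DynEquiv (system s (divisor i)) (system s (divisor j)) → i ≡ j
      distinct i j equiv = lookup-injective (divisors-unique m) (∣-antisym
        (equivalent⇒∣ s (divisor∣m i) (divisor∣m j) equiv)
        (equivalent⇒∣ s (divisor∣m j) (divisor∣m i)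
          (DynEquiv-sym {f = system s (divisor i)} {g = system s (divisor j)} equiv)))

      complete : ∀ (a : FiniteField.Units F) → ∃ λ i →
        DynEquiv (monomial F (proj₁ a) (suc s)) (monomial F (proj₁ (representative i)) (suc s))
      complete (a , a≢0) with α , refl ← discrete-log a≢0 =
        let k∈ = ∣⇒∈-divisors (gcd[m,n]∣n α m)
        in Any.index k∈ , subst (λ k → DynEquiv (system s α) (system s k)) (lookup-index k∈)
             (equivalent-to-divisor s α)

theorem3p5 : (q : ℕ) → (Σ ℕ λ p → Σ ℕ λ k → Prime p × k ≥ 1 × q ≡ p ^ k) →
    (F : FiniteField q) → (d : ℕ) → d ≥ 1 →
    HasNClasses {FiniteField.Units F}
    (λ a b → DynEquiv (monomial F (proj₁ a) d) (monomial F (proj₁ b) d))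
    (τ (gcd (d ∸ 1) (q ∸ 1)))
theorem3p5 zero _ F _ _ = contradiction (Inverse.from (FiniteField.card F) (FiniteField.0# F)) Fin.¬Fin0
-- With `q = suc n` and `d = suc s`, the truncated differences compute to `n` and `s`.
theorem3p5 (suc n) _ F (suc s) _ =
  let open FieldTheory F
      g , ord , exponent = generator
  in Dynamics.classes g ord exponent s
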